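{- Let $S=\{x_1,\dots,x_n\}$ be a factor closed set of $n$ distinct positive integers, and let $a,b$ be positive integers with $a\mid b$. Then, in the ring $M_n(\mathbb{Z})$, $$\big((x_i,x_j)^a\big)\,\big|\,\big((x_i,x_j)^b\big),\qquad \big((x_i,x_j)^a\big)\,\big|\,\big([x_i,x_j]^b\big),\qquad \big([x_i,x_j]^a\big)\,\big|\,\big([x_i,x_j]^b\big).$$
   Context: $(x,y)$ denotes the greatest common divisor and $[x,y]$ the least common multiple; $((x_i,x_j)^a)$ and $([x_i,x_j]^a)$ denote the $n\times n$ matrices with $(i,j)$-entries $(x_i,x_j)^a$ and $[x_i,x_j]^a$. For $A,B\in M_n(\mathbb{Z})$, $A\mid B$ means there is $C\in M_n(\mathbb{Z})$ with $B=AC$ or $B=CA$. A set $S$ of positive integers is factor closed if every positive divisor of every element of $S$ lies in $S$. -}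

module Defs where

open import Data.Integer.Base as ℤ using (ℤ; +_)
open import Data.Integer.Properties using (+-0-commutativeMonoid)
open import Data.Nat.Base using (ℕ; _^_; _<_)
open import Data.Nat.Divisibility using (_∣_)
open import Data.Nat.GCD using (gcd)
open import Data.Nat.LCM using (lcm)
open import Data.Product.Base using (∃-syntax)
open import Data.Sum.Base using (_⊎_)
open import Data.Vec.Functional using (Vector)
open import Relation.Binary.PropositionalEquality.Core using (_≡_)

open import Algebra.Properties.CommutativeMonoid.Sum +-0-commutativeMonoid
  using (sum)

Matrix : ℕ → Set
Matrix n = Vector (Vector ℤ n) n

infix  4 _≈ᴹ_ _∣ᴹ_
infixl 7 _*ᴹ_

-- Matrices are functions, so their equality is taken entrywise.
_≈ᴹ_ : ∀ {n} → Matrix n → Matrix n → Set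
A ≈ᴹ B = ∀ i j → A i j ≡ B i j

_*ᴹ_ : ∀ {n} → Matrix n → Matrix n → Matrix n
(A *ᴹ B) i j = sum (λ k → A i k ℤ.* B k j)

-- Divisibility on either side: the cofactor may stand on the right or on the
-- left.  (The library's _∣ˡ_ and _∣ʳ_ are the two one-sided versions.)
_∣ᴹ_ : ∀ {n} → Matrix n → Matrix n → Set
A ∣ᴹ B = ∃[ C ] (B ≈ᴹ A *ᴹ C ⊎ B ≈ᴹ C *ᴹ A)

-- A finite set {x₁,…,xₙ} is given by its enumeration x.
FactorClosed : ∀ {n} → Vector ℕ n → Set
FactorClosed x = ∀ i d → 0 < d → d ∣ x i → ∃[ j ] x j ≡ d

gcdMatrix : ∀ {n} → Vector ℕ n → ℕ → Matrix n
gcdMatrix x a i j = + (gcd (x i) (x j) ^ a)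

lcmMatrix : ∀ {n} → Vector ℕ n → ℕ → Matrix n
lcmMatrix x a i j = + (lcm (x i) (x j) ^ a)

{-# OPTIONS --safe #-}

-- Write J_a for the Jordan totient, the Möbius transform of n ↦ nᵃ, and let
-- R_a(d) = ∏_{p ∣ d} (1 − pᵃ), so that R_a(d) = dᵃ J_{−a}(d).  Then
--   (x,z)ᵃ = ∑_{d ∣ x} J_a(d) [d ∣ z]   and   [x,z]ᵃ = xᵃ ∑_{d ∣ x} R_a(d) [d ∣ z] (z/d)ᵃ.
-- As S is factor closed, all d occurring here lie in S, and the matrices [d ∣ z]
-- and [d ∣ z] (z/d)ᵃ over S are unitriangular, hence invertible over ℤ.  So it
-- suffices to expand the columns of the other matrix in the same way, over the
-- divisors of x, with coefficients divisible by J_a(d), respectively R_a(d).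
-- For the columns (x,y)ᵇ, [x,y]ᵇ and [x,y]ᵇ/xᵃ these coefficients factor
-- over the primes dividing d, and prime by prime the divisibility comes from
-- pᵃ − 1 ∣ pᵇ − 1.

module Submission where

open import Defs
open import Data.Bool.Base using (if_then_else_)
open import Data.Fin.Base as Fin using (Fin)
open import Data.Integer.Base as ℤ using (ℤ; +_; 0ℤ; 1ℤ)
import Data.Integer.Divisibility.Signed as ℤ
import Data.Integer.Properties as ℤ
import Data.Integer.Tactic.RingSolver as ℤSolver
open import Data.List.Base using (List; []; _∷_; _++_; map; foldr; filter; tabulate; upTo)
open import Data.List.Membership.Propositional using (_∈_)
open import Data.List.Membership.Propositional.Properties
  using ( ∈-filter⁺; ∈-filter⁻; ∈-tabulate⁺; ∈-tabulate⁻; ∈-upTo⁺; ∈-upTo⁻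
        ; ∈-map⁺; ∈-map⁻; ∈-++⁺ˡ; ∈-++⁺ʳ; ∈-++⁻)
open import Data.List.Membership.Propositional.Properties.WithK using (unique∧set⇒bag)
open import Data.List.Relation.Binary.BagAndSetEquality using (∼bag⇒↭)
open import Data.List.Relation.Binary.Permutation.Propositional as ↭ using (_↭_)
open import Data.List.Relation.Unary.All as All using (_∷_)
open import Data.List.Relation.Unary.AllPairs using (_∷_)
open import Data.List.Relation.Unary.Any using (here; there)
open import Data.List.Relation.Unary.Unique.Propositional using (Unique)
import Data.List.Relation.Unary.Unique.Propositional.Properties as Unique
open import Data.Nat.Base
open import Data.Nat.Coprimality using (Coprime; coprime-divisor)
open import Data.Nat.Divisibility
open import Data.Nat.GCD
open import Data.Nat.Induction using (<-rec)
open import Data.Nat.LCM using (lcm; gcd*lcm)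
open import Data.Nat.ListAction using (sum)
open import Data.Nat.Primality using (Prime; prime⇒irreducible; prime⇒nonZero; prime⇒nonTrivial)
open import Data.Nat.Primality.Factorisation using (factorise)
open import Data.Nat.Properties
open import Data.Nat.Tactic.RingSolver using (solve-∀)
open import Data.Product.Base using (∃₂; ∃-syntax; _×_; _,_; proj₁; proj₂)
open import Data.Sum.Base using (_⊎_; inj₁; inj₂)
open import Data.Vec.Functional using (Vector)
open import Function.Base using (_∘_; id)
open import Function.Bundles using (mk⇔)
open import Function.Definitions using (Injective)
open import Relation.Binary.Definitions using (tri<; tri≈; tri>)
open import Relation.Binary.PropositionalEquality
open import Relation.Nullary using (does; ¬_; yes; no; contradiction)
open import Relation.Unary using (Pred; Decidable)
open import Algebra.Properties.CommutativeMonoid.Sum ℤ.+-0-commutativeMonoid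
  using (sum-cong-≗) renaming (sum to ∑ᶠ)
open import Algebra.Properties.AbelianGroup ℤ.+-0-abelianGroup using (∙-cancelʳ)

-- Finite sums over lists of naturals.

∑ : (ℕ → ℤ) → List ℕ → ℤ
∑ f = foldr (λ z s → f z ℤ.+ s) 0ℤ

syntax ∑ (λ z → f) zs = ∑[ z ← zs ] f

∑-cong : ∀ {f g} zs → (∀ {z} → z ∈ zs → f z ≡ g z) → ∑ f zs ≡ ∑ g zs
∑-cong []       eq = refl
∑-cong (z ∷ zs) eq = cong₂ ℤ._+_ (eq (here refl)) (∑-cong zs (eq ∘ there))

∑-zero : ∀ {f} zs → (∀ {z} → z ∈ zs → f z ≡ 0ℤ) → ∑ f zs ≡ 0ℤ
∑-zero []       eq = refl
∑-zero (z ∷ zs) eq = cong₂ ℤ._+_ (eq (here refl)) (∑-zero zs (eq ∘ there))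

∑-++ : ∀ f ys {zs} → ∑ f (ys ++ zs) ≡ ∑ f ys ℤ.+ ∑ f zs
∑-++ f []       = sym (ℤ.+-identityˡ _)
∑-++ f (y ∷ ys) = trans (cong (ℤ._+_ (f y)) (∑-++ f ys)) (sym (ℤ.+-assoc (f y) _ _))

∑-map : ∀ f (h : ℕ → ℕ) zs → ∑ f (map h zs) ≡ ∑ (f ∘ h) zs
∑-map f h []       = refl
∑-map f h (z ∷ zs) = cong (ℤ._+_ (f (h z))) (∑-map f h zs)

∑-*ˡ : ∀ c f zs → c ℤ.* ∑ f zs ≡ ∑[ z ← zs ] (c ℤ.* f z)
∑-*ˡ c f []       = ℤ.*-zeroʳ c
∑-*ˡ c f (z ∷ zs) = trans (ℤ.*-distribˡ-+ c _ _) (cong (ℤ._+_ (c ℤ.* f z)) (∑-*ˡ c f zs))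

∑-+ : ∀ f g zs → ∑ f zs ℤ.+ ∑ g zs ≡ ∑[ z ← zs ] (f z ℤ.+ g z)
∑-+ f g []       = refl
∑-+ f g (z ∷ zs) = trans (interchange (f z) _ (g z) _) (cong (ℤ._+_ (f z ℤ.+ g z)) (∑-+ f g zs))
  where
  interchange : ∀ a b c d → (a ℤ.+ b) ℤ.+ (c ℤ.+ d) ≡ (a ℤ.+ c) ℤ.+ (b ℤ.+ d)
  interchange = ℤSolver.solve-∀

∑-swap : ∀ (f : ℕ → ℕ → ℤ) ys zs →
         ∑[ y ← ys ] (∑[ z ← zs ] f y z) ≡ ∑[ z ← zs ] (∑[ y ← ys ] f y z)
∑-swap f []       zs = sym (∑-zero zs (λ _ → refl))
∑-swap f (y ∷ ys) zs = trans (cong (ℤ._+_ (∑ (f y) zs)) (∑-swap f ys zs)) (∑-+ (f y) _ zs)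

∑-filter : ∀ {ℓ} {P : Pred ℕ ℓ} (P? : Decidable P) {f} zs → (∀ {z} → z ∈ zs → ¬ P z → f z ≡ 0ℤ) →
           ∑ f zs ≡ ∑ f (filter P? zs)
∑-filter P? [] _ = refl
∑-filter P? {f} (z ∷ zs) vanish with P? z
... | yes _  = cong (ℤ._+_ (f z)) (∑-filter P? zs (vanish ∘ there))
... | no  ¬p = trans (cong₂ ℤ._+_ (vanish (here refl) ¬p) (∑-filter P? zs (vanish ∘ there)))
                     (ℤ.+-identityˡ _)

∑-↭ : ∀ f {ys zs} → ys ↭ zs → ∑ f ys ≡ ∑ f zs
∑-↭ f ↭.refl         = refl
∑-↭ f (↭.prep z p)   = cong (ℤ._+_ (f z)) (∑-↭ f p)
∑-↭ f (↭.swap y z p) = trans (cong (λ s → f y ℤ.+ (f z ℤ.+ s)) (∑-↭ f p)) (exchange (f y) (f z) _)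
  where
  exchange : ∀ a b c → a ℤ.+ (b ℤ.+ c) ≡ b ℤ.+ (a ℤ.+ c)
  exchange = ℤSolver.solve-∀
∑-↭ f (↭.trans p q)  = trans (∑-↭ f p) (∑-↭ f q)

-- Duplicate-free lists with the same members are permutations of each other. Divisor sums can thus
-- be reindexed regardless of the order of listing.
∑-set : ∀ f {ys zs} → Unique ys → Unique zs →
        (∀ {z} → z ∈ ys → z ∈ zs) → (∀ {z} → z ∈ zs → z ∈ ys) → ∑ f ys ≡ ∑ f zs
∑-set f ys! zs! to from = ∑-↭ f (∼bag⇒↭ (unique∧set⇒bag ys! zs! (mk⇔ to from)))

-- Triangular systems of linear equations.

-- Solved by recursion on the rank, with the rank as fuel.
module TriangularSystem
  (rank : ℕ → ℕ) (prec : ℕ → List ℕ) (prec-< : ∀ {d z} → z ∈ prec d → rank z < rank d)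
  (c : ℕ → ℕ → ℤ) (s : ℕ → ℤ)
  where

  private
    approx : ℕ → ℕ → ℤ
    -- A dummy value: started with fuel above the rank, the recursion never gets here.
    approx zero    d = 0ℤ
    approx (suc k) d = s d ℤ.- ∑[ z ← prec d ] (c d z ℤ.* approx k z)

    -- Each unrolling passes to strictly smaller ranks, so fuel beyond the rank has no effect.
    approx-stable : ∀ k l d → rank d < k → rank d < l → approx k d ≡ approx l d
    approx-stable (suc k) (suc l) d (s≤s r≤k) (s≤s r≤l) = cong (λ t → s d ℤ.- t) (∑-cong (prec d)
      (λ {z} z∈ → cong (c d z ℤ.*_)
        (approx-stable k l z (<-≤-trans (prec-< z∈) r≤k) (<-≤-trans (prec-< z∈) r≤l))))

  solution : ℕ → ℤ
  solution d = approx (suc (rank d)) d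

  solution-eq : ∀ d → solution d ≡ s d ℤ.- ∑[ z ← prec d ] (c d z ℤ.* solution z)
  solution-eq d = cong (λ t → s d ℤ.- t) (∑-cong (prec d)
    (λ {z} z∈ → cong (c d z ℤ.*_) (approx-stable (rank d) (suc (rank z)) z (prec-< z∈) ≤-refl)))

-- Divisor sums and the Möbius transform.

-- divisors 0 is the junk value 0 ∷ [].
properDivisors divisors : ℕ → List ℕ
properDivisors n = filter (_∣? n) (upTo n)
divisors n = n ∷ properDivisors n

properDivisor-< : ∀ {n d} → d ∈ properDivisors n → d < n
properDivisor-< {n} d∈ = ∈-upTo⁻ (proj₁ (∈-filter⁻ (_∣? n) {xs = upTo n} d∈))

∈-divisors⁻ : ∀ {n d} → d ∈ divisors n → d ∣ n
∈-divisors⁻     (here refl) = ∣-refl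
∈-divisors⁻ {n} (there d∈)  = proj₂ (∈-filter⁻ (_∣? n) {xs = upTo n} d∈)

∈-divisors⁺ : ∀ {n d} → 0 < n → d ∣ n → d ∈ divisors n
∈-divisors⁺ {n} {d} 0<n d∣n with d ≟ n
... | yes refl = here refl
... | no  d≢n  = there (∈-filter⁺ (_∣? n)
  (∈-upTo⁺ (≤∧≢⇒< (∣⇒≤ {{>-nonZero 0<n}} d∣n) d≢n)) d∣n)

divisors-unique : ∀ n → Unique (divisors n)
divisors-unique n = All.tabulate (λ d∈ → ≢-sym (<⇒≢ (properDivisor-< d∈)))
                  ∷ Unique.filter⁺ (_∣? n) (Unique.upTo⁺ n)

∣⇒>0 : ∀ {d n} → 0 < n → d ∣ n → 0 < d
∣⇒>0 {zero}  0<n 0∣n = contradiction (sym (0∣⇒≡0 0∣n)) (<⇒≢ 0<n)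
∣⇒>0 {suc d} _   _   = z<s

-- The Möbius transform of g is solved for from its defining property,
-- without recourse to the Möbius function.
module _ (g : ℕ → ℤ) where
  open TriangularSystem id properDivisors properDivisor-< (λ _ _ → 1ℤ) g

  möbius : ℕ → ℤ
  möbius = solution

  ∑-möbius : ∀ n → ∑ möbius (divisors n) ≡ g n
  ∑-möbius n = begin
    möbius n ℤ.+ S              ≡⟨ cong (ℤ._+ S) (solution-eq n) ⟩
    (g n ℤ.- ∑[ z ← properDivisors n ] (1ℤ ℤ.* möbius z)) ℤ.+ S
      ≡⟨ cong (λ t → (g n ℤ.- t) ℤ.+ S)
           (∑-cong {g = möbius} (properDivisors n) (λ _ → ℤ.*-identityˡ _)) ⟩
    (g n ℤ.- S) ℤ.+ S           ≡⟨ cancel (g n) S ⟩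
    g n                         ∎
    where
    open ≡-Reasoning
    S = ∑ möbius (properDivisors n)
    cancel : ∀ a b → (a ℤ.- b) ℤ.+ b ≡ a
    cancel = ℤSolver.solve-∀

-- Uniqueness in Möbius inversion: by strong induction the terms at proper divisors agree, so they
-- cancel from the two sums at `n`. Equality is asked only at divisors of `n`, which leaves room for
-- side conditions such as `¬ p ∣ d`.
divisorSum-injective : ∀ f g n → 0 < n →
                       (∀ {d} → 0 < d → d ∣ n → ∑ f (divisors d) ≡ ∑ g (divisors d)) →
                       f n ≡ g n
divisorSum-injective f g = <-rec _ step
  where
  step : ∀ n → (∀ {m} → m < n → 0 < m →
                  (∀ {d} → 0 < d → d ∣ m → ∑ f (divisors d) ≡ ∑ g (divisors d)) → f m ≡ g m) →
         0 < n → (∀ {d} → 0 < d → d ∣ n → ∑ f (divisors d) ≡ ∑ g (divisors d)) → f n ≡ g n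
  step n rec 0<n eq = ∙-cancelʳ (∑ g (properDivisors n)) _ _ (begin
    f n ℤ.+ ∑ g (properDivisors n) ≡⟨ cong (ℤ._+_ (f n)) (∑-cong (properDivisors n) ih) ⟨
    ∑ f (divisors n)               ≡⟨ eq 0<n ∣-refl ⟩
    ∑ g (divisors n)               ∎)
    where
    open ≡-Reasoning
    ih : ∀ {d} → d ∈ properDivisors n → f d ≡ g d
    ih d∈ = rec (properDivisor-< d∈) (∣⇒>0 0<n d∣n) (λ 0<e e∣d → eq 0<e (∣-trans e∣d d∣n))
      where d∣n = ∈-divisors⁻ (there d∈)

-- Powers, and factorisation at a single prime.

^-distribʳ-* : ∀ k m n → (m * n) ^ k ≡ m ^ k * n ^ k
^-distribʳ-* zero    m n = refl
^-distribʳ-* (suc k) m n = trans (cong (m * n *_) (^-distribʳ-* k m n)) (interchange m n _ _)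
  where
  interchange : ∀ a b c d → a * b * (c * d) ≡ a * c * (b * d)
  interchange = solve-∀

^-monoʳ-∣ : ∀ p {k l} → k ≤ l → p ^ k ∣ p ^ l
^-monoʳ-∣ p {k} {l} k≤l = divides (p ^ (l ∸ k))
  (trans (cong (p ^_) (sym (m∸n+n≡m k≤l))) (^-distribˡ-+-* p (l ∸ k) k))

*>0 : ∀ {m n} → 0 < m → 0 < n → 0 < m * n
*>0 {suc m} {suc n} _ _ = z<s

module _ {p : ℕ} (p-prime : Prime p) where
  private instance
    p≢0 = prime⇒nonZero p-prime
    1<p = prime⇒nonTrivial p-prime

  ^>0 : ∀ k → 0 < p ^ k
  ^>0 = m^n>0 p

  coprime-factor : ∀ k {d m} → ¬ p ∣ d → d ∣ p ^ k * m → d ∣ m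
  coprime-factor zero    {d} {m} p∤d d∣m = subst (d ∣_) (*-identityˡ m) d∣m
  coprime-factor (suc k) {d} {m} p∤d d∣  = coprime-factor k p∤d
    (coprime-divisor d⊥p (subst (d ∣_) (*-assoc p (p ^ k) m) d∣))
    where
    d⊥p : Coprime d p
    d⊥p (i∣d , i∣p) with prime⇒irreducible p-prime i∣p
    ... | inj₁ i≡1  = i≡1
    ... | inj₂ refl = contradiction i∣d p∤d

  valuation : ∀ n → 0 < n → ∃₂ λ k m → n ≡ p ^ k * m × ¬ p ∣ m × 0 < m
  valuation = <-rec _ step
    where
    step : ∀ n → (∀ {l} → l < n → 0 < l → ∃₂ λ k m → l ≡ p ^ k * m × ¬ p ∣ m × 0 < m) →
           0 < n → ∃₂ λ k m → n ≡ p ^ k * m × ¬ p ∣ m × 0 < m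
    step n rec 0<n with p ∣? n
    ... | no  p∤n            = 0 , n , sym (*-identityˡ n) , p∤n , 0<n
    ... | yes (divides q eq) =
      let q∣n = divides p (trans eq (*-comm q p))
          0<q = ∣⇒>0 0<n q∣n
          q<n = subst (q <_) (sym eq) (m<m*n q p {{>-nonZero 0<q}} (nonTrivial⇒n>1 p))
          k , m , q≡ , p∤m , 0<m = rec q<n 0<q
          n≡ = trans eq (trans (*-comm q p) (trans (cong (p *_) q≡) (sym (*-assoc p (p ^ k) m))))
      in suc k , m , n≡ , p∤m , 0<m

  -- While both exponents are positive, a common factor `p` is pulled out. Once one exponent is `0`,
  -- that argument is not divisible by `p`, and the power of `p` in the other does not affect the
  -- gcd.
  gcd-split : ∀ i e {m y} → ¬ p ∣ m → ¬ p ∣ y → gcd (p ^ i * m) (p ^ e * y) ≡ p ^ (i ⊓ e) * gcd m y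
  gcd-split zero e {m} {y} p∤m p∤y = begin
    gcd (1 * m) (p ^ e * y) ≡⟨ cong (λ l → gcd l (p ^ e * y)) (*-identityˡ m) ⟩
    g                       ≡⟨ ∣-antisym (gcd-greatest g∣m g∣y) (gcd-greatest (gcd[m,n]∣m m y) gcd∣p^e*y) ⟩
    gcd m y                 ≡⟨ *-identityˡ _ ⟨
    1 * gcd m y             ∎
    where
    open ≡-Reasoning
    g   = gcd m (p ^ e * y)
    g∣m = gcd[m,n]∣m m (p ^ e * y)
    g∣y = coprime-factor e (λ p∣g → p∤m (∣-trans p∣g g∣m)) (gcd[m,n]∣n m (p ^ e * y))
    gcd∣p^e*y = ∣-trans (gcd[m,n]∣n m y) (n∣m*n (p ^ e))
  gcd-split (suc i) zero {m} {y} p∤m p∤y = begin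
    gcd (p ^ suc i * m) (1 * y) ≡⟨ gcd-comm (p ^ suc i * m) (1 * y) ⟩
    gcd (1 * y) (p ^ suc i * m) ≡⟨ gcd-split zero (suc i) p∤y p∤m ⟩
    1 * gcd y m                 ≡⟨ cong (1 *_) (gcd-comm y m) ⟩
    1 * gcd m y                 ∎
    where open ≡-Reasoning
  gcd-split (suc i) (suc e) {m} {y} p∤m p∤y = begin
    gcd (p ^ suc i * m) (p ^ suc e * y)         ≡⟨ cong₂ gcd (*-assoc p _ m) (*-assoc p _ y) ⟩
    gcd (p * (p ^ i * m)) (p * (p ^ e * y))     ≡⟨ c*gcd[m,n]≡gcd[cm,cn] p _ _ ⟨
    p * gcd (p ^ i * m) (p ^ e * y)             ≡⟨ cong (p *_) (gcd-split i e p∤m p∤y) ⟩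
    p * (p ^ (i ⊓ e) * gcd m y)                 ≡⟨ *-assoc p _ _ ⟨
    p ^ suc (i ⊓ e) * gcd m y                   ∎
    where open ≡-Reasoning

  -- Divisors of `p ^ suc k * m` are sorted by their exponent of `p`: if it is at most `k`, they
  -- divide `p ^ k * m`; if it is `suc k`, they are `p ^ suc k` times a divisor of `m`.
  ∑-divisors-split : ∀ f k {m} → ¬ p ∣ m → 0 < m →
    ∑ f (divisors (p ^ suc k * m)) ≡
      ∑ f (divisors (p ^ k * m)) ℤ.+ ∑[ d ← divisors m ] f (p ^ suc k * d)
  ∑-divisors-split f k {m} p∤m 0<m = begin
    ∑ f (divisors (p ^ suc k * m))
      ≡⟨ ∑-set f (divisors-unique _) split-unique to from ⟩
    ∑ f (divisors (p ^ k * m) ++ map (p ^ suc k *_) (divisors m))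
      ≡⟨ ∑-++ f (divisors (p ^ k * m)) ⟩
    ∑ f (divisors (p ^ k * m)) ℤ.+ ∑ f (map (p ^ suc k *_) (divisors m))
      ≡⟨ cong (ℤ._+_ (∑ f (divisors (p ^ k * m)))) (∑-map f (p ^ suc k *_) (divisors m)) ⟩
    ∑ f (divisors (p ^ k * m)) ℤ.+ ∑[ d ← divisors m ] f (p ^ suc k * d) ∎
    where
    open ≡-Reasoning
    instance
      p^k≢0 = m^n≢0 p k
      p^sk≢0 = m^n≢0 p (suc k)

    ^∤ : ∀ l {j} → l < j → ¬ p ^ j ∣ p ^ l * m
    ^∤ l {j} l<j p^j∣ = p∤m (*-cancelˡ-∣ (p ^ l) {{m^n≢0 p l}}
      (∣-trans (subst (_∣ p ^ j) (*-comm p (p ^ l)) (^-monoʳ-∣ p l<j)) p^j∣))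
    split-unique : Unique (divisors (p ^ k * m) ++ map (p ^ suc k *_) (divisors m))
    split-unique = Unique.++⁺ (divisors-unique _)
      (Unique.map⁺ (*-cancelˡ-≡ _ _ (p ^ suc k)) (divisors-unique m)) disjoint
      where
      disjoint : ∀ {d} → ¬ (d ∈ divisors (p ^ k * m) × d ∈ map (p ^ suc k *_) (divisors m))
      disjoint (d∈₁ , d∈₂) with ∈-map⁻ (p ^ suc k *_) d∈₂
      ... | d′ , _ , refl = ^∤ k ≤-refl (∣-trans (m∣m*n d′) (∈-divisors⁻ d∈₁))

    to : ∀ {d} → d ∈ divisors (p ^ suc k * m) →
         d ∈ divisors (p ^ k * m) ++ map (p ^ suc k *_) (divisors m)
    to {d} d∈ with valuation d (∣⇒>0 (*>0 (^>0 (suc k)) 0<m) (∈-divisors⁻ d∈))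
    ... | i , d′ , refl , p∤d′ , _ with <-cmp i (suc k)
    ...   | tri< i<sk _ _ = ∈-++⁺ˡ (∈-divisors⁺ (*>0 (^>0 k) 0<m)
        (*-pres-∣ (^-monoʳ-∣ p (s≤s⁻¹ i<sk)) d′∣m))
      where d′∣m = coprime-factor (suc k) p∤d′ (∣-trans (n∣m*n (p ^ i)) (∈-divisors⁻ d∈))
    ...   | tri≈ _ refl _ = ∈-++⁺ʳ (divisors (p ^ k * m)) (∈-map⁺ (p ^ suc k *_) (∈-divisors⁺ 0<m d′∣m))
      where d′∣m = coprime-factor (suc k) p∤d′ (∣-trans (n∣m*n (p ^ i)) (∈-divisors⁻ d∈))
    ...   | tri> _ _ sk<i = contradiction (∣-trans (m∣m*n d′) (∈-divisors⁻ d∈)) (^∤ (suc k) sk<i)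

    from : ∀ {d} → d ∈ divisors (p ^ k * m) ++ map (p ^ suc k *_) (divisors m) →
           d ∈ divisors (p ^ suc k * m)
    from d∈ with ∈-++⁻ (divisors (p ^ k * m)) d∈
    ... | inj₁ d∈₁ = ∈-divisors⁺ (*>0 (^>0 (suc k)) 0<m)
      (∣-trans (∈-divisors⁻ d∈₁) (*-monoˡ-∣ m (n∣m*n p)))
    ... | inj₂ d∈₂ with ∈-map⁻ (p ^ suc k *_) d∈₂
    ...   | _ , d′∈ , refl = ∈-divisors⁺ (*>0 (^>0 (suc k)) 0<m)
      (*-monoʳ-∣ (p ^ suc k) (∈-divisors⁻ d′∈))

  -- For `d` dividing `m`, the divisors that `p ^ suc k * d` has beyond those of `p ^ k * d` are the
  -- `p ^ suc k * e` with `e ∣ d`. Summing the transform over them gives `g (p ^ suc k * d)` minus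
  -- `g (p ^ k * d)`, and uniqueness of the transform concludes. `g′` may differ from `g`, since
  -- stripping `p` will also change the parameter `y` of a mixed power.
  möbius-split : ∀ g g′ (T : ℕ → ℤ) →
    (∀ i {m} → ¬ p ∣ m → 0 < m → g (p ^ i * m) ≡ T i ℤ.* g′ m) →
    ∀ k {m} → ¬ p ∣ m → 0 < m → möbius g (p ^ suc k * m) ≡ (T (suc k) ℤ.- T k) ℤ.* möbius g′ m
  möbius-split g g′ T g-split k {m} p∤m 0<m =
    divisorSum-injective (λ d → möbius g (p ^ suc k * d)) (λ d → ΔT ℤ.* möbius g′ d) m 0<m
      (λ {d} 0<d d∣m → sums (λ p∣d → p∤m (∣-trans p∣d d∣m)) 0<d)
    where
    open ≡-Reasoning
    ΔT = T (suc k) ℤ.- T k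
    cancel : ∀ a b c → a ≡ b ℤ.+ c → c ≡ a ℤ.- b
    cancel a b c refl = lem b c
      where
      lem : ∀ b c → c ≡ (b ℤ.+ c) ℤ.- b
      lem = ℤSolver.solve-∀
    factor : ∀ a b c → a ℤ.* c ℤ.- b ℤ.* c ≡ (a ℤ.- b) ℤ.* c
    factor = ℤSolver.solve-∀
    sums : ∀ {d} → ¬ p ∣ d → 0 < d →
           ∑[ e ← divisors d ] möbius g (p ^ suc k * e) ≡ ∑[ e ← divisors d ] (ΔT ℤ.* möbius g′ e)
    sums {d} p∤d 0<d = begin
      ∑[ e ← divisors d ] möbius g (p ^ suc k * e)
        ≡⟨ cancel _ (∑ (möbius g) (divisors (p ^ k * d))) _ (∑-divisors-split (möbius g) k p∤d 0<d) ⟩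
      ∑ (möbius g) (divisors (p ^ suc k * d)) ℤ.- ∑ (möbius g) (divisors (p ^ k * d))
        ≡⟨ cong₂ ℤ._-_ (∑-möbius g (p ^ suc k * d)) (∑-möbius g (p ^ k * d)) ⟩
      g (p ^ suc k * d) ℤ.- g (p ^ k * d)   ≡⟨ cong₂ ℤ._-_ (g-split (suc k) p∤d 0<d) (g-split k p∤d 0<d) ⟩
      T (suc k) ℤ.* g′ d ℤ.- T k ℤ.* g′ d   ≡⟨ factor (T (suc k)) (T k) (g′ d) ⟩
      ΔT ℤ.* g′ d                           ≡⟨ cong (ΔT ℤ.*_) (∑-möbius g′ d) ⟨
      ΔT ℤ.* ∑ (möbius g′) (divisors d)     ≡⟨ ∑-*ˡ ΔT (möbius g′) (divisors d) ⟩
      ∑[ e ← divisors d ] (ΔT ℤ.* möbius g′ e) ∎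

-- Cofactors and mixed powers.

-- y/(x,y), so that [x,y] = x · cofactor x y.
cofactor : ℕ → ℕ → ℕ
cofactor x y = quotient (gcd[m,n]∣n x y)

cofactor-eq : ∀ x y → y ≡ cofactor x y * gcd x y
cofactor-eq x y = _∣_.equality (gcd[m,n]∣n x y)

gcd>0 : ∀ x {y} → 0 < y → 0 < gcd x y
gcd>0 x {y} 0<y = ∣⇒>0 0<y (gcd[m,n]∣n x y)

cofactor-unique : ∀ x y {q} → 0 < y → y ≡ q * gcd x y → cofactor x y ≡ q
cofactor-unique x y 0<y eq =
  *-cancelʳ-≡ _ _ (gcd x y) {{>-nonZero (gcd>0 x 0<y)}} (trans (sym (cofactor-eq x y)) eq)

cofactor-∣ : ∀ {x y q} → 0 < y → y ≡ q * x → cofactor x y ≡ q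
cofactor-∣ {x} {y} {q} 0<y eq = cofactor-unique x y 0<y (trans eq (cong (q *_) (sym gcd≡x)))
  where
  gcd≡x : gcd x y ≡ x
  gcd≡x = ∣-antisym (gcd[m,n]∣m x y) (gcd-greatest ∣-refl (divides q eq))

lcm≡*cofactor : ∀ x {y} → 0 < y → lcm x y ≡ x * cofactor x y
lcm≡*cofactor x {y} 0<y = *-cancelˡ-≡ _ _ (gcd x y) {{>-nonZero (gcd>0 x 0<y)}} (begin
  gcd x y * lcm x y              ≡⟨ gcd*lcm x y ⟩
  x * y                          ≡⟨ cong (x *_) (cofactor-eq x y) ⟩
  x * (cofactor x y * gcd x y)   ≡⟨ rearrange x (cofactor x y) (gcd x y) ⟩
  gcd x y * (x * cofactor x y)   ∎)
  where
  open ≡-Reasoning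
  rearrange : ∀ a b c → a * (b * c) ≡ c * (a * b)
  rearrange = solve-∀

-- The powers (x,z)ᵃ and [x,y]ᵇ/xᵃ are both special cases, as functions of x:
-- they are mixedPower a 0 1 (x,z) and mixedPower (b − a) b y x.
mixedPower : ℕ → ℕ → ℕ → ℕ → ℤ
mixedPower c b y x = + (x ^ c * cofactor x y ^ b)

-- The contribution of p to mixedPower c b y x when p has exponent i in x and e in y.
localFactor : ℕ → ℕ → ℕ → ℕ → ℕ → ℤ
localFactor p c b e i = + ((p ^ i) ^ c * (p ^ (e ∸ i)) ^ b)

module _ {p : ℕ} (p-prime : Prime p) where

  -- The exponent of `p` in y/(x,y) is `e` minus `i ⊓ e`, which truncated subtraction expresses as
  -- `e ∸ i`.
  cofactor-split : ∀ i e {m y} → ¬ p ∣ m → ¬ p ∣ y → 0 < y →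
                   cofactor (p ^ i * m) (p ^ e * y) ≡ p ^ (e ∸ i) * cofactor m y
  cofactor-split i e {m} {y} p∤m p∤y 0<y =
    cofactor-unique (p ^ i * m) (p ^ e * y) (*>0 (^>0 p-prime e) 0<y) (begin
    p ^ e * y
      ≡⟨ cong₂ _*_
           (trans (cong (p ^_) (sym (m⊓n+n∸m≡n i e))) (^-distribˡ-+-* p (i ⊓ e) (e ∸ i)))
           (cofactor-eq m y) ⟩
    (p ^ (i ⊓ e) * p ^ (e ∸ i)) * (cofactor m y * gcd m y)
      ≡⟨ rearrange (p ^ (i ⊓ e)) (p ^ (e ∸ i)) (cofactor m y) (gcd m y) ⟩
    (p ^ (e ∸ i) * cofactor m y) * (p ^ (i ⊓ e) * gcd m y)
      ≡⟨ cong (p ^ (e ∸ i) * cofactor m y *_) (gcd-split p-prime i e p∤m p∤y) ⟨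
    (p ^ (e ∸ i) * cofactor m y) * gcd (p ^ i * m) (p ^ e * y) ∎)
    where
    open ≡-Reasoning
    rearrange : ∀ a b c d → (a * b) * (c * d) ≡ (b * c) * (a * d)
    rearrange = solve-∀

  mixedPower-split : ∀ c b e {y} → ¬ p ∣ y → 0 < y → ∀ i {m} → ¬ p ∣ m → 0 < m →
            mixedPower c b (p ^ e * y) (p ^ i * m) ≡ localFactor p c b e i ℤ.* mixedPower c b y m
  mixedPower-split c b e {y} p∤y 0<y i {m} p∤m _ = trans (cong +_ (begin
    (p ^ i * m) ^ c * cofactor (p ^ i * m) (p ^ e * y) ^ b
      ≡⟨ cong (λ q → (p ^ i * m) ^ c * q ^ b) (cofactor-split i e p∤m p∤y 0<y) ⟩
    (p ^ i * m) ^ c * (p ^ (e ∸ i) * cofactor m y) ^ b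
      ≡⟨ cong₂ _*_ (^-distribʳ-* c (p ^ i) m) (^-distribʳ-* b (p ^ (e ∸ i)) _) ⟩
    ((p ^ i) ^ c * m ^ c) * ((p ^ (e ∸ i)) ^ b * cofactor m y ^ b)
      ≡⟨ rearrange ((p ^ i) ^ c) _ _ _ ⟩
    ((p ^ i) ^ c * (p ^ (e ∸ i)) ^ b) * (m ^ c * cofactor m y ^ b) ∎))
    (ℤ.pos-* ((p ^ i) ^ c * (p ^ (e ∸ i)) ^ b) _)
    where
    open ≡-Reasoning
    rearrange : ∀ a b c d → (a * b) * (c * d) ≡ (a * c) * (b * d)
    rearrange = solve-∀

  möbius-mixedPower-split : ∀ c b e {y} → ¬ p ∣ y → 0 < y → ∀ k {m} → ¬ p ∣ m → 0 < m →
    möbius (mixedPower c b (p ^ e * y)) (p ^ suc k * m)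
      ≡ (localFactor p c b e (suc k) ℤ.- localFactor p c b e k) ℤ.* möbius (mixedPower c b y) m
  möbius-mixedPower-split c b e {y} p∤y 0<y =
    möbius-split p-prime (mixedPower c b (p ^ e * y)) (mixedPower c b y) (localFactor p c b e)
      (mixedPower-split c b e p∤y 0<y)

-- Differences of local factors.

-- From exponent `e` on, the cofactor contributes `1`, and only the power with exponent `c` grows.
localFactor-≥ : ∀ p c b {e k} → e ≤ k →
  localFactor p c b e (suc k) ℤ.- localFactor p c b e k ≡ + ((p ^ k) ^ c) ℤ.* (+ (p ^ c) ℤ.- 1ℤ)
localFactor-≥ p c b {e} {k} e≤k = begin
  + ((p ^ suc k) ^ c * (p ^ (e ∸ suc k)) ^ b) ℤ.- + ((p ^ k) ^ c * (p ^ (e ∸ k)) ^ b)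
    ≡⟨ cong₂ (λ u v → + u ℤ.- + v)
         (trans (unit (suc k) (m≤n⇒m≤1+n e≤k)) (^-distribʳ-* c p (p ^ k))) (unit k e≤k) ⟩
  + (p ^ c * (p ^ k) ^ c) ℤ.- + ((p ^ k) ^ c)
    ≡⟨ cong (ℤ._- + ((p ^ k) ^ c)) (ℤ.pos-* (p ^ c) _) ⟩
  + (p ^ c) ℤ.* + ((p ^ k) ^ c) ℤ.- + ((p ^ k) ^ c)
    ≡⟨ rearrange (+ (p ^ c)) _ ⟩
  + ((p ^ k) ^ c) ℤ.* (+ (p ^ c) ℤ.- 1ℤ) ∎
  where
  open ≡-Reasoning
  unit : ∀ i → e ≤ i → (p ^ i) ^ c * (p ^ (e ∸ i)) ^ b ≡ (p ^ i) ^ c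
  unit i e≤i = trans
    (cong ((p ^ i) ^ c *_) (trans (cong (λ j → (p ^ j) ^ b) (m≤n⇒m∸n≡0 e≤i)) (^-zeroˡ b)))
    (*-identityʳ _)
  rearrange : ∀ u v → u ℤ.* v ℤ.- v ≡ v ℤ.* (u ℤ.- 1ℤ)
  rearrange = ℤSolver.solve-∀

-- Below `e`, one more factor `p` in `x` gains `p ^ c` and takes `p ^ b` away from the cofactor
-- part.
localFactor-< : ∀ p c b {e k} → k < e →
  localFactor p c b e (suc k) ℤ.- localFactor p c b e k
    ≡ + ((p ^ k) ^ c * (p ^ (e ∸ suc k)) ^ b) ℤ.* (+ (p ^ c) ℤ.- + (p ^ b))
localFactor-< p c b {e} {k} k<e = begin
  + ((p * p ^ k) ^ c * Q) ℤ.- + (P * (p ^ (e ∸ k)) ^ b)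
    ≡⟨ cong (λ j → + ((p * p ^ k) ^ c * Q) ℤ.- + (P * (p ^ j) ^ b)) (+-∸-assoc 1 k<e) ⟩
  + ((p * p ^ k) ^ c * Q) ℤ.- + (P * (p * p ^ (e ∸ suc k)) ^ b)
    ≡⟨ cong₂ (λ u v → + (u * Q) ℤ.- + (P * v)) (^-distribʳ-* c p (p ^ k)) (^-distribʳ-* b p _) ⟩
  + (p ^ c * P * Q) ℤ.- + (P * (p ^ b * Q))
    ≡⟨ cong₂ (λ u v → + u ℤ.- + v) (first (p ^ c) P Q) (second (p ^ b) P Q) ⟩
  + (P * Q * p ^ c) ℤ.- + (P * Q * p ^ b)
    ≡⟨ cong₂ ℤ._-_ (ℤ.pos-* (P * Q) _) (ℤ.pos-* (P * Q) _) ⟩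
  + (P * Q) ℤ.* + (p ^ c) ℤ.- + (P * Q) ℤ.* + (p ^ b)
    ≡⟨ factor (+ (P * Q)) _ _ ⟩
  + (P * Q) ℤ.* (+ (p ^ c) ℤ.- + (p ^ b)) ∎
  where
  open ≡-Reasoning
  P = (p ^ k) ^ c
  Q = (p ^ (e ∸ suc k)) ^ b
  first : ∀ u v w → u * v * w ≡ v * w * u
  first = solve-∀
  second : ∀ u v w → v * (u * w) ≡ v * w * u
  second = solve-∀
  factor : ∀ u v w → u ℤ.* v ℤ.- u ℤ.* w ≡ u ℤ.* (v ℤ.- w)
  factor = ℤSolver.solve-∀

-- With P = `p ^ a` and `b = q * a`, induction on `q` uses P · P^q - 1 = P(P^q - 1) + (P - 1).
pow-1∣pow-1 : ∀ p {a b} → a ∣ b → + (p ^ a) ℤ.- 1ℤ ℤ.∣ + (p ^ b) ℤ.- 1ℤ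
pow-1∣pow-1 p {a} {b} (divides q b≡q*a) =
  subst (λ t → + (p ^ a) ℤ.- 1ℤ ℤ.∣ + t ℤ.- 1ℤ)
    (trans (^-*-assoc p a q) (cong (p ^_) (trans (*-comm a q) (sym b≡q*a)))) (go q)
  where
  P = p ^ a
  telescope : ∀ u v → u ℤ.* (v ℤ.- 1ℤ) ℤ.+ (u ℤ.- 1ℤ) ≡ u ℤ.* v ℤ.- 1ℤ
  telescope = ℤSolver.solve-∀
  go : ∀ q → + P ℤ.- 1ℤ ℤ.∣ + (P ^ q) ℤ.- 1ℤ
  go zero    = ℤ.divides 0ℤ refl
  go (suc q) = subst (+ P ℤ.- 1ℤ ℤ.∣_)
    (trans (telescope (+ P) (+ (P ^ q))) (cong (ℤ._- 1ℤ) (sym (ℤ.pos-* P (P ^ q)))))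
    (ℤ.∣m∣n⇒∣m+n (ℤ.∣n⇒∣m*n (+ P) (go q)) ℤ.∣-refl)

-- From divisibility at each prime to divisibility at every `d`.

primeFactor : ∀ n → 1 < n → ∃[ p ] Prime p × p ∣ n
primeFactor n@(suc _) 1<n with factorise n
... | record { factors = []     ; isFactorisation = n≡1 } = contradiction (sym n≡1) (<⇒≢ 1<n)
... | record { factors = p ∷ ps ; isFactorisation = n≡ ; factorsPrime = p-prime ∷ _ } =
  p , p-prime , subst (p ∣_) (sym n≡) (m∣m*n _)

module _
  (κ : ℕ → ℤ) (τ : ℕ → ℕ → ℤ) (κ-1 : κ 1 ≡ 1ℤ)
  (κ-split : ∀ {p} → Prime p → ∀ k {m} → ¬ p ∣ m → 0 < m → κ (p ^ suc k * m) ≡ τ p k ℤ.* κ m)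
  (c b : ℕ) (τ∣Δ : ∀ p e k → τ p k ℤ.∣ localFactor p c b e (suc k) ℤ.- localFactor p c b e k)
  where

  -- By induction on `d`, a prime `p` dividing `d` is stripped from both `d` and `y`. The two sides
  -- then split off `τ p k` and a difference of local factors, related by `τ∣Δ`. As `y` loses its
  -- power of `p` too, it is quantified inside the induction.
  κ∣möbius-mixedPower : ∀ d → 0 < d → ∀ {y} → 0 < y → κ d ℤ.∣ möbius (mixedPower c b y) d
  κ∣möbius-mixedPower = <-rec _ step
    where
    step : ∀ d → (∀ {m} → m < d → 0 < m → ∀ {y} → 0 < y → κ m ℤ.∣ möbius (mixedPower c b y) m) →
           0 < d → ∀ {y} → 0 < y → κ d ℤ.∣ möbius (mixedPower c b y) d
    step 1 _ _ {y} _ = ℤ.divides w (sym (trans (cong (ℤ._*_ w) κ-1) (ℤ.*-identityʳ w)))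
      where w = möbius (mixedPower c b y) 1
    step d@(2+ _) rec 0<d {y} 0<y with primeFactor d (s<s z<s)
    ... | p , p-prime , p∣d with valuation p-prime d 0<d | valuation p-prime y 0<y
    ...   | zero  , m , d≡ , p∤m , _   | _ =
      contradiction (subst (p ∣_) (trans d≡ (*-identityˡ m)) p∣d) p∤m
    ...   | suc k , m , d≡ , p∤m , 0<m | e , y′ , y≡ , p∤y′ , 0<y′
      = subst₂ (λ d y → κ d ℤ.∣ möbius (mixedPower c b y) d) (sym d≡) (sym y≡) (subst₂ ℤ._∣_
        (sym (κ-split p-prime k p∤m 0<m))
        (sym (möbius-mixedPower-split p-prime c b e p∤y′ 0<y′ k p∤m 0<m))
        (ℤ.∣-trans (ℤ.*-monoʳ-∣ (τ p k) (rec m<d 0<m 0<y′))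
          (ℤ.*-monoˡ-∣ (möbius (mixedPower c b y′) m) (τ∣Δ p e k))))
      where
      m<d : m < d
      m<d = subst (m <_) (trans (*-comm m _) (sym d≡))
        (m<m*n m (p ^ suc k) {{>-nonZero 0<m}} (^-monoʳ-< p 1<p {0} {suc k} z<s))
        where 1<p = nonTrivial⇒n>1 p {{prime⇒nonTrivial p-prime}}

-- Jordan totients and their reciprocal analogue.

mixedPower-1 : ∀ c b {y} → 0 < y → mixedPower c b y 1 ≡ + (y ^ b)
mixedPower-1 c b {y} 0<y = cong +_ (trans
  (cong₂ _*_ (^-zeroˡ c) (cong (_^ b) (cofactor-∣ 0<y (sym (*-identityʳ y)))))
  (*-identityˡ _))

möbius-1 : ∀ g → möbius g 1 ≡ g 1
möbius-1 g = trans (sym (ℤ.+-identityʳ _)) (∑-möbius g 1)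

-- The Jordan totient J_a: with cofactor exponent `0` the mixed power is n ↦ nᵃ. This form makes the
-- splitting of mixed powers available, with `y = 1` having exponent `0` at every prime.
jordan : ℕ → ℕ → ℤ
jordan a = möbius (mixedPower a 0 1)

jordan-1 : ∀ a → jordan a 1 ≡ 1ℤ
jordan-1 a = trans (möbius-1 (mixedPower a 0 1)) (mixedPower-1 a 0 {1} z<s)

jordan-split : ∀ a {p} → Prime p → ∀ k {m} → ¬ p ∣ m → 0 < m →
          jordan a (p ^ suc k * m) ≡ (+ ((p ^ k) ^ a) ℤ.* (+ (p ^ a) ℤ.- 1ℤ)) ℤ.* jordan a m
jordan-split a {p} p-prime k {m} p∤m 0<m =
  trans (möbius-mixedPower-split p-prime a 0 0 p∤1 z<s k p∤m 0<m)
        (cong (ℤ._* jordan a m) (localFactor-≥ p a 0 {0} {k} z≤n))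
  where
  p∤1 : ¬ p ∣ 1
  p∤1 p∣1 = nonTrivial⇒≢1 {{prime⇒nonTrivial p-prime}} (∣1⇒≡1 p∣1)

-- ∏_{p ∣ d} (1 − pᵃ): the Möbius transform of n ↦ n⁻ᵃ, multiplied by dᵃ.
reciprocalJordan : ℕ → ℕ → ℤ
reciprocalJordan a d = möbius (mixedPower 0 a d) d

reciprocalJordan-1 : ∀ a → reciprocalJordan a 1 ≡ 1ℤ
reciprocalJordan-1 a = trans (möbius-1 (mixedPower 0 a 1))
  (trans (mixedPower-1 0 a z<s) (cong +_ (^-zeroˡ a)))

-- Here `y` is the argument itself, so `e = suc k` and the step from `k` to `suc k` is the last one
-- below `e`. The remaining cofactor exponent is `0`, so the factor does not depend on `k`.
reciprocalJordan-split : ∀ a {p} → Prime p → ∀ k {m} → ¬ p ∣ m → 0 < m →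
          reciprocalJordan a (p ^ suc k * m) ≡ (1ℤ ℤ.- + (p ^ a)) ℤ.* reciprocalJordan a m
reciprocalJordan-split a {p} p-prime k {m} p∤m 0<m =
  trans (möbius-mixedPower-split p-prime 0 a (suc k) p∤m 0<m k p∤m 0<m)
    (cong (ℤ._* reciprocalJordan a m) (begin
    localFactor p 0 a (suc k) (suc k) ℤ.- localFactor p 0 a (suc k) k
      ≡⟨ localFactor-< p 0 a {suc k} {k} ≤-refl ⟩
    + (1 * (p ^ (k ∸ k)) ^ a) ℤ.* (1ℤ ℤ.- + (p ^ a))
      ≡⟨ cong (λ t → + t ℤ.* (1ℤ ℤ.- + (p ^ a)))
           (trans (*-identityˡ _) (trans (cong (λ j → (p ^ j) ^ a) (n∸n≡0 k)) (^-zeroˡ a))) ⟩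
    1ℤ ℤ.* (1ℤ ℤ.- + (p ^ a))
      ≡⟨ ℤ.*-identityˡ _ ⟩
    1ℤ ℤ.- + (p ^ a) ∎))
  where open ≡-Reasoning

-- Divisibility of the expansion coefficients.

-- The case `c ≡ 0` serves the gcd columns, `c ≡ b` the lcm columns. From the exponent of `p` in `y`
-- on, the local difference is `(p ^ k) ^ b` times `p ^ b` - 1; below it, it is the same for `c ≡ 0`
-- and zero for `c ≡ b`.
jordan∣möbius-mixedPower : ∀ {a b} → a ∣ b → a ≤ b → ∀ {c} → c ≡ 0 ⊎ c ≡ b →
             ∀ d → 0 < d → ∀ {y} → 0 < y → jordan a d ℤ.∣ möbius (mixedPower b c y) d
jordan∣möbius-mixedPower {a} {b} a∣b a≤b {c} c≡0⊎b =
  κ∣möbius-mixedPower (jordan a) τ (jordan-1 a) (jordan-split a) b c τ∣Δ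
  where
  τ : ℕ → ℕ → ℤ
  τ p k = + ((p ^ k) ^ a) ℤ.* (+ (p ^ a) ℤ.- 1ℤ)

  τ∣top : ∀ p k → τ p k ℤ.∣ + ((p ^ k) ^ b) ℤ.* (+ (p ^ b) ℤ.- 1ℤ)
  τ∣top p k = ℤ.∣-trans (ℤ.*-monoʳ-∣ (+ ((p ^ k) ^ a)) (pow-1∣pow-1 p a∣b))
    (ℤ.*-monoˡ-∣ (+ (p ^ b) ℤ.- 1ℤ) power∣power)
    where
    power∣power : + ((p ^ k) ^ a) ℤ.∣ + ((p ^ k) ^ b)
    power∣power = ℤ.∣ᵤ⇒∣ (^-monoʳ-∣ (p ^ k) a≤b)

  τ∣bottom : ∀ p e k → c ≡ 0 ⊎ c ≡ b →
    τ p k ℤ.∣ + ((p ^ k) ^ b * (p ^ (e ∸ suc k)) ^ c) ℤ.* (+ (p ^ b) ℤ.- + (p ^ c))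
  τ∣bottom p e k (inj₁ refl) =
    subst (λ t → τ p k ℤ.∣ + t ℤ.* (+ (p ^ b) ℤ.- 1ℤ)) (sym (*-identityʳ ((p ^ k) ^ b))) (τ∣top p k)
  τ∣bottom p e k (inj₂ refl) = ℤ.divides 0ℤ
    (trans (cong (ℤ._*_ w) (ℤ.+-inverseʳ (+ (p ^ b)))) (ℤ.*-zeroʳ w))
    where w = + ((p ^ k) ^ b * (p ^ (e ∸ suc k)) ^ b)

  τ∣Δ : ∀ p e k → τ p k ℤ.∣ localFactor p b c e (suc k) ℤ.- localFactor p b c e k
  τ∣Δ p e k with e ≤? k
  ... | yes e≤k = subst (τ p k ℤ.∣_) (sym (localFactor-≥ p b c e≤k)) (τ∣top p k)
  ... | no  e≰k = subst (τ p k ℤ.∣_) (sym (localFactor-< p b c (≰⇒> e≰k))) (τ∣bottom p e k c≡0⊎b)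

-- Here `c` stands for b - a. The local difference is a multiple of `p ^ c` - 1 from the exponent of
-- `p` in `y` on, and of `p ^ c` - `p ^ (a + c)` = `p ^ c` (1 - `p ^ a`) below it.
reciprocalJordan∣möbius-mixedPower : ∀ {a c} → a ∣ c → ∀ d → 0 < d → ∀ {y} → 0 < y →
  reciprocalJordan a d ℤ.∣ möbius (mixedPower c (a + c) y) d
reciprocalJordan∣möbius-mixedPower {a} {c} a∣c =
  κ∣möbius-mixedPower (reciprocalJordan a) (λ p _ → 1ℤ ℤ.- + (p ^ a))
    (reciprocalJordan-1 a) (reciprocalJordan-split a) c (a + c) τ∣Δ
  where
  negate : ∀ u → (ℤ.- 1ℤ) ℤ.* (1ℤ ℤ.- u) ≡ u ℤ.- 1ℤ
  negate = ℤSolver.solve-∀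
  factor : ∀ u v → u ℤ.* (1ℤ ℤ.- v) ≡ u ℤ.- u ℤ.* v
  factor = ℤSolver.solve-∀

  τ∣Δ : ∀ p e k → 1ℤ ℤ.- + (p ^ a) ℤ.∣
        localFactor p c (a + c) e (suc k) ℤ.- localFactor p c (a + c) e k
  τ∣Δ p e k with e ≤? k
  ... | yes e≤k = subst (_ ℤ.∣_) (sym (localFactor-≥ p c (a + c) e≤k))
    (ℤ.∣n⇒∣m*n (+ ((p ^ k) ^ c)) (ℤ.∣-trans
      (ℤ.divides (ℤ.- 1ℤ) (sym (negate (+ (p ^ a))))) (pow-1∣pow-1 p a∣c)))
  ... | no  e≰k = subst (_ ℤ.∣_) (sym (localFactor-< p c (a + c) (≰⇒> e≰k)))
    (ℤ.∣n⇒∣m*n (+ ((p ^ k) ^ c * (p ^ (e ∸ suc k)) ^ (a + c))) (ℤ.divides (+ (p ^ c)) (begin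
      + (p ^ c) ℤ.- + (p ^ (a + c))
        ≡⟨ cong (λ t → + (p ^ c) ℤ.- + t) (trans (^-distribˡ-+-* p a c) (*-comm (p ^ a) _)) ⟩
      + (p ^ c) ℤ.- + (p ^ c * p ^ a)           ≡⟨ cong (λ t → + (p ^ c) ℤ.- t) (ℤ.pos-* (p ^ c) _) ⟩
      + (p ^ c) ℤ.- + (p ^ c) ℤ.* + (p ^ a)     ≡⟨ factor (+ (p ^ c)) _ ⟨
      + (p ^ c) ℤ.* (1ℤ ℤ.- + (p ^ a))          ∎)))
    where open ≡-Reasoning

-- Expansions of gcd and lcm powers over divisors.

-- [d ∣ z] (z/d)ᵃ
pairing : ℕ → ℕ → ℕ → ℤ
pairing a d z = if does (d ∣? z) then mixedPower 0 a z d else 0ℤ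

pairing-∣ : ∀ a {d z} → d ∣ z → pairing a d z ≡ mixedPower 0 a z d
pairing-∣ a {d} {z} d∣z with d ∣? z
... | yes _   = refl
... | no  d∤z = contradiction d∣z d∤z

pairing-∤ : ∀ a {d z} → ¬ d ∣ z → pairing a d z ≡ 0ℤ
pairing-∤ a {d} {z} d∤z with d ∣? z
... | yes d∣z = contradiction d∣z d∤z
... | no  _   = refl

pairing-diagonal : ∀ a {d} → 0 < d → pairing a d d ≡ 1ℤ
pairing-diagonal a {d} 0<d = trans (pairing-∣ a (∣-refl {d}))
  (cong +_ (trans (*-identityˡ _)
    (trans (cong (_^ a) (cofactor-∣ 0<d (sym (*-identityˡ d)))) (^-zeroˡ a))))

pairing-> : ∀ a {d z} → 0 < z → z < d → pairing a d z ≡ 0ℤ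
pairing-> a 0<z z<d = pairing-∤ a (λ d∣z → <⇒≱ z<d (∣⇒≤ {{>-nonZero 0<z}} d∣z))

-- The pairing removes the divisors of `x` that do not divide `z`; those left are the divisors of
-- the gcd.
∑-pairing : ∀ (f : ℕ → ℤ) a {x z} → 0 < x → 0 < z →
  ∑[ d ← divisors x ] (f d ℤ.* pairing a d z) ≡
    ∑[ d ← divisors (gcd x z) ] (f d ℤ.* mixedPower 0 a z d)
∑-pairing f a {x} {z} 0<x 0<z = begin
  ∑ term (divisors x)
    ≡⟨ ∑-filter (_∣? z) (divisors x) (λ {d} _ d∤z →
         trans (cong (ℤ._*_ (f d)) (pairing-∤ a d∤z)) (ℤ.*-zeroʳ (f d))) ⟩
  ∑ term (filter (_∣? z) (divisors x))
    ≡⟨ ∑-set term (Unique.filter⁺ (_∣? z) (divisors-unique x)) (divisors-unique (gcd x z)) to from ⟩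
  ∑ term (divisors (gcd x z))
    ≡⟨ ∑-cong (divisors (gcd x z)) (λ {d} d∈ →
         cong (ℤ._*_ (f d)) (pairing-∣ a (∣-trans (∈-divisors⁻ d∈) (gcd[m,n]∣n x z)))) ⟩
  ∑[ d ← divisors (gcd x z) ] (f d ℤ.* mixedPower 0 a z d) ∎
  where
  open ≡-Reasoning
  term : ℕ → ℤ
  term d = f d ℤ.* pairing a d z
  to : ∀ {d} → d ∈ filter (_∣? z) (divisors x) → d ∈ divisors (gcd x z)
  to d∈ = let d∈x , d∣z = ∈-filter⁻ (_∣? z) {xs = divisors x} d∈
          in ∈-divisors⁺ (gcd>0 x 0<z) (gcd-greatest (∈-divisors⁻ d∈x) d∣z)
  from : ∀ {d} → d ∈ divisors (gcd x z) → d ∈ filter (_∣? z) (divisors x)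
  from d∈ = ∈-filter⁺ (_∣? z) (∈-divisors⁺ 0<x (∣-trans d∣g (gcd[m,n]∣m x z)))
                               (∣-trans d∣g (gcd[m,n]∣n x z))
    where d∣g = ∈-divisors⁻ d∈

mixedPower-zeroʳ : ∀ c y x → mixedPower c 0 y x ≡ + (x ^ c)
mixedPower-zeroʳ c y x = cong +_ (*-identityʳ (x ^ c))

gcd-expansion : ∀ a {x z} → 0 < x → 0 < z →
  + (gcd x z ^ a) ≡ ∑[ d ← divisors x ] (jordan a d ℤ.* pairing 0 d z)
gcd-expansion a {x} {z} 0<x 0<z = begin
  + (gcd x z ^ a)                                             ≡⟨ mixedPower-zeroʳ a 1 (gcd x z) ⟨
  mixedPower a 0 1 (gcd x z)                                  ≡⟨ ∑-möbius (mixedPower a 0 1) (gcd x z) ⟨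
  ∑ (jordan a) (divisors (gcd x z))
    ≡⟨ ∑-cong (divisors (gcd x z)) (λ {d} _ →
         sym (trans (cong (ℤ._*_ (jordan a d)) (mixedPower-zeroʳ 0 z d)) (ℤ.*-identityʳ (jordan a d)))) ⟩
  ∑[ d ← divisors (gcd x z) ] (jordan a d ℤ.* mixedPower 0 0 z d) ≡⟨ ∑-pairing (jordan a) 0 0<x 0<z ⟨
  ∑[ d ← divisors x ] (jordan a d ℤ.* pairing 0 d z)          ∎
  where open ≡-Reasoning

mixedPower-trans : ∀ a {e d z} → 0 < z → e ∣ d → d ∣ z →
  mixedPower 0 a z e ≡ mixedPower 0 a z d ℤ.* mixedPower 0 a d e
mixedPower-trans a {e} {d} {z} 0<z (divides q d≡q*e) (divides r z≡r*d) = begin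
  + (1 * cofactor e z ^ a)
    ≡⟨ cong (λ t → + (1 * t ^ a))
         (cofactor-∣ 0<z (trans z≡r*d (trans (cong (r *_) d≡q*e) (sym (*-assoc r q e))))) ⟩
  + (1 * (r * q) ^ a)
    ≡⟨ cong +_ (trans (cong (1 *_) (^-distribʳ-* a r q)) (rearrange (r ^ a) (q ^ a))) ⟩
  + (1 * r ^ a * (1 * q ^ a))
    ≡⟨ ℤ.pos-* (1 * r ^ a) _ ⟩
  + (1 * r ^ a) ℤ.* + (1 * q ^ a)
    ≡⟨ cong₂ (λ u v → + (1 * u ^ a) ℤ.* + (1 * v ^ a)) (cofactor-∣ 0<z z≡r*d) (cofactor-∣ 0<d d≡q*e) ⟨
  mixedPower 0 a z d ℤ.* mixedPower 0 a d e ∎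
  where
  open ≡-Reasoning
  0<d = ∣⇒>0 0<z (divides r z≡r*d)
  rearrange : ∀ u v → 1 * (u * v) ≡ 1 * u * (1 * v)
  rearrange = solve-∀

-- On divisors e of `d`, (z/e)ᵃ = (z/d)ᵃ (d/e)ᵃ with a first factor independent of e, so the
-- transforms differ by that constant. This separates the dependence on `z` from a coefficient in
-- `d` alone.
möbius-mixedPower-∣ : ∀ a {d z} → 0 < z → d ∣ z →
  möbius (mixedPower 0 a z) d ≡ reciprocalJordan a d ℤ.* mixedPower 0 a z d
möbius-mixedPower-∣ a {d} {z} 0<z d∣z = trans
  (divisorSum-injective (möbius (mixedPower 0 a z)) (λ e → w ℤ.* möbius (mixedPower 0 a d) e)
    d (∣⇒>0 0<z d∣z) (λ {e} _ e∣d → begin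
    ∑ (möbius (mixedPower 0 a z)) (divisors e)      ≡⟨ ∑-möbius (mixedPower 0 a z) e ⟩
    mixedPower 0 a z e                              ≡⟨ mixedPower-trans a 0<z e∣d d∣z ⟩
    w ℤ.* mixedPower 0 a d e                        ≡⟨ cong (ℤ._*_ w) (∑-möbius (mixedPower 0 a d) e) ⟨
    w ℤ.* ∑ (möbius (mixedPower 0 a d)) (divisors e) ≡⟨ ∑-*ˡ w (möbius (mixedPower 0 a d)) (divisors e) ⟩
    ∑[ e′ ← divisors e ] (w ℤ.* möbius (mixedPower 0 a d) e′) ∎))
  (ℤ.*-comm w _)
  where
  open ≡-Reasoning
  w = mixedPower 0 a z d

-- The exponent is split so that exactly `x ^ c` can be taken out as a row factor: `c` is 0 against
-- the gcd matrix and `a` against the lcm matrix.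
lcm-mixedPower : ∀ c e x {y} → 0 < y → + (lcm x y ^ (c + e)) ≡ + (x ^ c) ℤ.* mixedPower e (c + e) y x
lcm-mixedPower c e x {y} 0<y = begin
  + (lcm x y ^ (c + e))
    ≡⟨ cong (λ l → + (l ^ (c + e))) (lcm≡*cofactor x 0<y) ⟩
  + ((x * cofactor x y) ^ (c + e))
    ≡⟨ cong +_ (^-distribʳ-* (c + e) x (cofactor x y)) ⟩
  + (x ^ (c + e) * cofactor x y ^ (c + e))
    ≡⟨ cong (λ t → + (t * cofactor x y ^ (c + e))) (^-distribˡ-+-* x c e) ⟩
  + (x ^ c * x ^ e * cofactor x y ^ (c + e))
    ≡⟨ cong +_ (*-assoc (x ^ c) (x ^ e) _) ⟩
  + (x ^ c * (x ^ e * cofactor x y ^ (c + e)))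
    ≡⟨ ℤ.pos-* (x ^ c) _ ⟩
  + (x ^ c) ℤ.* mixedPower e (c + e) y x ∎
  where open ≡-Reasoning

mixedPower-gcd : ∀ a x {z} → 0 < z → mixedPower 0 a z (gcd x z) ≡ mixedPower 0 a z x
mixedPower-gcd a x {z} 0<z = cong (λ q → + (1 * q ^ a)) (cofactor-∣ 0<z (cofactor-eq x z))

lcm-expansion : ∀ a {x z} → 0 < x → 0 < z →
  + (lcm x z ^ a) ≡ + (x ^ a) ℤ.* ∑[ d ← divisors x ] (reciprocalJordan a d ℤ.* pairing a d z)
lcm-expansion a {x} {z} 0<x 0<z = begin
  + (lcm x z ^ a)
    ≡⟨ cong (λ e → + (lcm x z ^ e)) (+-identityʳ a) ⟨
  + (lcm x z ^ (a + 0))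
    ≡⟨ lcm-mixedPower a 0 x 0<z ⟩
  + (x ^ a) ℤ.* mixedPower 0 (a + 0) z x
    ≡⟨ cong (λ e → + (x ^ a) ℤ.* mixedPower 0 e z x) (+-identityʳ a) ⟩
  + (x ^ a) ℤ.* mixedPower 0 a z x
    ≡⟨ cong (ℤ._*_ (+ (x ^ a))) (mixedPower-gcd a x 0<z) ⟨
  + (x ^ a) ℤ.* mixedPower 0 a z g
    ≡⟨ cong (ℤ._*_ (+ (x ^ a))) (∑-möbius (mixedPower 0 a z) g) ⟨
  + (x ^ a) ℤ.* ∑ (möbius (mixedPower 0 a z)) (divisors g)
    ≡⟨ cong (ℤ._*_ (+ (x ^ a))) (∑-cong (divisors g) (λ d∈ →
         möbius-mixedPower-∣ a 0<z (∣-trans (∈-divisors⁻ d∈) (gcd[m,n]∣n x z)))) ⟩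
  + (x ^ a) ℤ.* ∑[ d ← divisors g ] (reciprocalJordan a d ℤ.* mixedPower 0 a z d)
    ≡⟨ cong (ℤ._*_ (+ (x ^ a))) (∑-pairing (reciprocalJordan a) a 0<x 0<z) ⟨
  + (x ^ a) ℤ.* ∑[ d ← divisors x ] (reciprocalJordan a d ℤ.* pairing a d z) ∎
  where
  open ≡-Reasoning
  g = gcd x z

-- Unitriangular systems over a finite set.

-- The sum is a crude upper bound that makes `sum zs ∸ z` a rank decreasing in `z`.
∈⇒≤sum : ∀ {z zs} → z ∈ zs → z ≤ sum zs
∈⇒≤sum (here refl)       = m≤m+n _ _
∈⇒≤sum {zs = y ∷ _} (there z∈) = ≤-trans (∈⇒≤sum z∈) (m≤n+m _ y)

module _ (zs : List ℕ) (zs! : Unique zs)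
  (q : ℕ → ℕ → ℤ) (q-diagonal : ∀ {d} → d ∈ zs → q d d ≡ 1ℤ)
  (q-lower : ∀ {d z} → z ∈ zs → z < d → q d z ≡ 0ℤ) (s : ℕ → ℤ)
  where

  private
    above : ℕ → List ℕ
    above d = filter (d <?_) zs

    above-rank : ∀ {d z} → z ∈ above d → sum zs ∸ z < sum zs ∸ d
    above-rank {d} z∈ = let z∈zs , d<z = ∈-filter⁻ (d <?_) {xs = zs} z∈
                        in ∸-monoʳ-< d<z (∈⇒≤sum z∈zs)

  open TriangularSystem (sum zs ∸_) above above-rank q s

  -- Back substitution from the largest element down: the equation at `d` involves only `v d`, with
  -- coefficient 1, and values at larger elements.
  unitriangular-solvable : ∃[ v ] ∀ {d} → d ∈ zs → ∑[ z ← zs ] (q d z ℤ.* v z) ≡ s d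
  unitriangular-solvable = solution , λ {d} d∈ → let term = λ z → q d z ℤ.* solution z in begin
    ∑ term zs
      ≡⟨ ∑-filter (d ≤?_) zs (λ z∈ d≰z → cong (ℤ._* solution _) (q-lower z∈ (≰⇒> d≰z))) ⟩
    ∑ term (filter (d ≤?_) zs)
      ≡⟨ ∑-set term (Unique.filter⁺ (d ≤?_) zs!) (d∷above-unique d) (to d) (from d d∈) ⟩
    term d ℤ.+ ∑ term (above d)
      ≡⟨ cong (λ t → t ℤ.* solution d ℤ.+ ∑ term (above d)) (q-diagonal d∈) ⟩
    1ℤ ℤ.* solution d ℤ.+ ∑ term (above d)
      ≡⟨ cong (λ t → 1ℤ ℤ.* t ℤ.+ ∑ term (above d)) (solution-eq d) ⟩
    1ℤ ℤ.* (s d ℤ.- ∑ term (above d)) ℤ.+ ∑ term (above d)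
      ≡⟨ cancel (s d) (∑ term (above d)) ⟩
    s d ∎
    where
    open ≡-Reasoning
    cancel : ∀ a b → 1ℤ ℤ.* (a ℤ.- b) ℤ.+ b ≡ a
    cancel = ℤSolver.solve-∀

    d∷above-unique : ∀ d → Unique (d ∷ above d)
    d∷above-unique d = All.tabulate (λ z∈ → <⇒≢ (proj₂ (∈-filter⁻ (d <?_) {xs = zs} z∈)))
                     ∷ Unique.filter⁺ (d <?_) zs!

    to : ∀ d {z} → z ∈ filter (d ≤?_) zs → z ∈ d ∷ above d
    to d {z} z∈ with ∈-filter⁻ (d ≤?_) {xs = zs} z∈ | d ≟ z
    ... | _    , _   | yes refl = here refl
    ... | z∈zs , d≤z | no  d≢z  = there (∈-filter⁺ (d <?_) z∈zs (≤∧≢⇒< d≤z d≢z))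

    from : ∀ d → d ∈ zs → ∀ {z} → z ∈ d ∷ above d → z ∈ filter (d ≤?_) zs
    from d d∈ (here refl) = ∈-filter⁺ (d ≤?_) d∈ ≤-refl
    from d d∈ (there z∈)  = let z∈zs , d<z = ∈-filter⁻ (d <?_) {xs = zs} z∈
                            in ∈-filter⁺ (d ≤?_) z∈zs (<⇒≤ d<z)

-- Construction of the matrix quotient.

sum-tabulate : ∀ {n} (f : ℕ → ℤ) (x : Vector ℕ n) → ∑ᶠ (f ∘ x) ≡ ∑ f (tabulate x)
sum-tabulate {zero}  f x = refl
sum-tabulate {suc n} f x = cong (ℤ._+_ (f (x Fin.zero))) (sum-tabulate f (x ∘ Fin.suc))

module _ {n} (x : Vector ℕ n) (x>0 : ∀ i → 0 < x i)
  (x-injective : Injective _≡_ _≡_ x) (closed : FactorClosed x)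
  where

  private
    ∈-tabulate⇒>0 : ∀ {z} → z ∈ tabulate x → 0 < z
    ∈-tabulate⇒>0 z∈ with ∈-tabulate⁻ {f = x} z∈
    ... | i , refl = x>0 i

    divisor∈ : ∀ i {d} → d ∈ divisors (x i) → d ∈ tabulate x
    divisor∈ i {d} d∈ =
      let d∣x = ∈-divisors⁻ d∈
          j , x≡d = closed i d (∣⇒>0 (x>0 i) d∣x) d∣x
      in subst (_∈ tabulate x) x≡d (∈-tabulate⁺ j)

  -- In matrix form A = D E K Q and B = D E H, with D = diag(`P`), E the divisor incidence matrix, K
  -- = diag(`κ`) and Q the pairing matrix. By hypothesis H = K T over ℤ, and Q V = T is solvable
  -- since Q is unitriangular, so B = A V.
  expansion⇒∣ᴹ : ∀ {A B : Matrix n} (P : Vector ℤ n) (κ : ℕ → ℤ) a (h : Vector (ℕ → ℤ) n) →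
    (∀ i k → A i k ≡ P i ℤ.* ∑[ d ← divisors (x i) ] (κ d ℤ.* pairing a d (x k))) →
    (∀ i j → B i j ≡ P i ℤ.* ∑ (h j) (divisors (x i))) →
    (∀ j d → 0 < d → κ d ℤ.∣ h j d) →
    A ∣ᴹ B
  expansion⇒∣ᴹ {A} {B} P κ a h A-eq B-eq κ∣h = (λ k j → v j (x k)) , inj₁ product
    where
    open ≡-Reasoning
    s : Vector (ℕ → ℤ) n
    -- A filler value: the quotients exist for positive `d`, and `0` is not in the set.
    s j zero      = 0ℤ
    s j d@(suc _) = ℤ.quotient (κ∣h j d z<s)

    h≡κ*s : ∀ j {d} → 0 < d → h j d ≡ κ d ℤ.* s j d
    h≡κ*s j {d@(suc _)} _ = trans (ℤ._∣_.equality (κ∣h j d z<s)) (ℤ.*-comm (s j d) (κ d))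

    solve : ∀ j → ∃[ v ] ∀ {d} → d ∈ tabulate x → ∑[ z ← tabulate x ] (pairing a d z ℤ.* v z) ≡ s j d
    solve j = unitriangular-solvable (tabulate x) (Unique.tabulate⁺ x-injective) (pairing a)
      (λ d∈ → pairing-diagonal a (∈-tabulate⇒>0 d∈)) (λ z∈ → pairing-> a (∈-tabulate⇒>0 z∈)) (s j)

    v : Vector (ℕ → ℤ) n
    v j = proj₁ (solve j)

    term : Fin n → ℕ → ℕ → ℤ
    term j d z = κ d ℤ.* (pairing a d z ℤ.* v j z)

    entry : Fin n → ℕ → ℤ
    entry i z = P i ℤ.* ∑[ d ← divisors (x i) ] (κ d ℤ.* pairing a d z)

    column : ∀ i j {d} → d ∈ divisors (x i) → h j d ≡ ∑ (term j d) (tabulate x)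
    column i j {d} d∈ = begin
      h j d                                   ≡⟨ h≡κ*s j (∈-tabulate⇒>0 (divisor∈ i d∈)) ⟩
      -- Factor closedness enters here: `d` lies in the set, so the system has an equation at `d`.
      κ d ℤ.* s j d                           ≡⟨ cong (ℤ._*_ (κ d)) (proj₂ (solve j) (divisor∈ i d∈)) ⟨
      κ d ℤ.* ∑[ z ← tabulate x ] (pairing a d z ℤ.* v j z)
        ≡⟨ ∑-*ˡ (κ d) (λ z → pairing a d z ℤ.* v j z) (tabulate x) ⟩
      ∑ (term j d) (tabulate x)               ∎

    collect : ∀ i j z → P i ℤ.* (∑[ d ← divisors (x i) ] term j d z) ≡ entry i z ℤ.* v j z
    collect i j z = begin
      P i ℤ.* (∑[ d ← divisors (x i) ] term j d z)
        ≡⟨ cong (ℤ._*_ (P i)) (∑-cong (divisors (x i)) (λ {d} _ →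
             rotate (κ d) (pairing a d z) (v j z))) ⟩
      P i ℤ.* (∑[ d ← divisors (x i) ] (v j z ℤ.* (κ d ℤ.* pairing a d z)))
        ≡⟨ cong (ℤ._*_ (P i)) (∑-*ˡ (v j z) (λ d → κ d ℤ.* pairing a d z) (divisors (x i))) ⟨
      P i ℤ.* (v j z ℤ.* ∑[ d ← divisors (x i) ] (κ d ℤ.* pairing a d z))
        ≡⟨ exchange (P i) (v j z) (∑[ d ← divisors (x i) ] (κ d ℤ.* pairing a d z)) ⟩
      entry i z ℤ.* v j z ∎
      where
      rotate : ∀ a b c → a ℤ.* (b ℤ.* c) ≡ c ℤ.* (a ℤ.* b)
      rotate = ℤSolver.solve-∀
      exchange : ∀ a b c → a ℤ.* (b ℤ.* c) ≡ a ℤ.* c ℤ.* b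
      exchange = ℤSolver.solve-∀

    product : B ≈ᴹ A *ᴹ (λ k j → v j (x k))
    product i j = begin
      B i j
        ≡⟨ B-eq i j ⟩
      P i ℤ.* ∑ (h j) (divisors (x i))
        ≡⟨ cong (ℤ._*_ (P i)) (∑-cong (divisors (x i)) (column i j)) ⟩
      P i ℤ.* (∑[ d ← divisors (x i) ] (∑[ z ← tabulate x ] term j d z))
        ≡⟨ cong (ℤ._*_ (P i)) (∑-swap (term j) (divisors (x i)) (tabulate x)) ⟩
      P i ℤ.* (∑[ z ← tabulate x ] (∑[ d ← divisors (x i) ] term j d z))
        ≡⟨ ∑-*ˡ (P i) (λ z → ∑[ d ← divisors (x i) ] term j d z) (tabulate x) ⟩
      ∑[ z ← tabulate x ] (P i ℤ.* (∑[ d ← divisors (x i) ] term j d z))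
        ≡⟨ ∑-cong (tabulate x) (λ {z} _ → collect i j z) ⟩
      ∑[ z ← tabulate x ] (entry i z ℤ.* v j z)
        ≡⟨ sum-tabulate (λ z → entry i z ℤ.* v j z) x ⟨
      ∑ᶠ (λ k → entry i (x k) ℤ.* v j (x k))
        ≡⟨ sum-cong-≗ (λ k → cong (ℤ._* v j (x k)) (A-eq i k)) ⟨
      (A *ᴹ (λ k j → v j (x k))) i j ∎

theorem3p1 : ∀ (n : ℕ) (x : Vector ℕ n) →
    (∀ i → 0 < x i) →
    Injective _≡_ _≡_ x →
    FactorClosed x →
    ∀ (a b : ℕ) → 0 < a → 0 < b → a ∣ b →
    (gcdMatrix x a ∣ᴹ gcdMatrix x b)
    × (gcdMatrix x a ∣ᴹ lcmMatrix x b)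
    × (lcmMatrix x a ∣ᴹ lcmMatrix x b)
theorem3p1 n x x>0 x-injective closed a b 0<a 0<b a∣b =
    expansion (λ _ → 1ℤ) (jordan a) 0 (λ j d → jordan b d ℤ.* pairing 0 d (x j))
      (gcd-eq a) (gcd-eq b)
      (λ j d 0<d → ℤ.∣m⇒∣m*n (pairing 0 d (x j))
        -- With `y = 1` and cofactor exponent `0`, the transform is `jordan b` by definition.
        (jordan∣möbius-mixedPower a∣b a≤b (inj₁ refl) d 0<d {1} z<s))
  , expansion (λ _ → 1ℤ) (jordan a) 0 (λ j → möbius (mixedPower b b (x j))) (gcd-eq a) (lcm-eq 0 b)
      (λ j d 0<d → jordan∣möbius-mixedPower a∣b a≤b (inj₂ refl) d 0<d (x>0 j))
  -- `b` is written as `a + (b ∸ a)` so that both matrices have the row factor `x i ^ a`.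
  , subst (λ e → lcmMatrix x a ∣ᴹ lcmMatrix x e) (m+[n∸m]≡n a≤b)
      (expansion (λ i → + (x i ^ a)) (reciprocalJordan a) a
        (λ j → möbius (mixedPower (b ∸ a) (a + (b ∸ a)) (x j)))
        (λ i k → lcm-expansion a (x>0 i) (x>0 k)) (lcm-eq a (b ∸ a))
        (λ j d 0<d → reciprocalJordan∣möbius-mixedPower a∣b∸a d 0<d (x>0 j)))
  where
  expansion = expansion⇒∣ᴹ x x>0 x-injective closed
  a≤b = ∣⇒≤ {{>-nonZero 0<b}} a∣b
  a∣b∸a = ∣m+n∣m⇒∣n (subst (a ∣_) (sym (m+[n∸m]≡n a≤b)) a∣b) ∣-refl

  gcd-eq : ∀ c i k → gcdMatrix x c i k ≡
           1ℤ ℤ.* ∑[ d ← divisors (x i) ] (jordan c d ℤ.* pairing 0 d (x k))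
  gcd-eq c i k = trans (gcd-expansion c (x>0 i) (x>0 k)) (sym (ℤ.*-identityˡ _))

  lcm-eq : ∀ c e i j → lcmMatrix x (c + e) i j ≡
           + (x i ^ c) ℤ.* ∑ (möbius (mixedPower e (c + e) (x j))) (divisors (x i))
  lcm-eq c e i j = trans (lcm-mixedPower c e (x i) (x>0 j))
    (cong (ℤ._*_ (+ (x i ^ c))) (sym (∑-möbius (mixedPower e (c + e) (x j)) (x i))))
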